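{- Let $G$ be a cubic graph of order $2n$ (i.e. with $2n$ vertices). Then the number of perfect matchings of $G$ equals the expected value $$\operatorname{PerMat}(G) = \operatorname{E}(X),$$ where $X$ is the random variable defined on the set of all $2$-colorings $c$ of the edges of $G$, each coloring being equally likely, by $X(c) = (-3)^{m_c}$, where $m_c$ is the number of vertices of $G$ that are incident in $c$ with three edges of the same color.
   Context: Graphs are finite. $\operatorname{PerMat}(G)$ denotes the number of perfect matchings of $G$. A $2$-coloring of the edges is an arbitrary map from the edge set $E(G)$ to a fixed set of two colors (not required to be proper); since $|E(G)|=3n$, there are $2^{3n}$ of them, and the expectation is over the uniform distribution on these. -}

module Defs where

open import Data.Bool using (true; false)
open import Data.Fin using (Fin)
open import Data.Fin.Properties using (_≟_; all?; any?)
open import Data.Fin.Subset using (Subset; _∈_)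
open import Data.Fin.Subset.Properties using (_∈?_)
open import Data.Integer as ℤ using (ℤ; +_; -[1+_]; 0ℤ)
open import Data.List as List using (List; []; _∷_; concatMap; filter; foldr; length)
open import Data.Nat as ℕ using (ℕ; zero; suc; _^_)
open import Data.Nat.Properties using (m^n≢0)
open import Data.Product using (∃-syntax; _×_)
open import Data.Rational as ℚ using (ℚ)
open import Data.Sum using (_⊎_)
open import Data.Vec as Vec using (Vec; []; _∷_; count; lookup; allFin)
open import Relation.Binary.PropositionalEquality using (_≡_; _≢_)
open import Relation.Nullary using (Dec; _×-dec_; _⊎-dec_)

-- Finite graphs with vertex set Fin order.  Edges carry names, so parallel
-- edges are allowed; a simple graph is one where no two edges have the same
-- ends.  The order of the two ends of an edge is immaterial: everything below
-- refers to them only through the symmetric relation Incident.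
record Graph (order : ℕ) : Set where
  field
    size     : ℕ
    end₁     : Fin size → Fin order
    end₂     : Fin size → Fin order
    loopless : ∀ e → end₁ e ≢ end₂ e

  Vertex : Set
  Vertex = Fin order

  Edge : Set
  Edge = Fin size

  Incident : Vertex → Edge → Set
  Incident v e = v ≡ end₁ e ⊎ v ≡ end₂ e

  incident? : ∀ v e → Dec (Incident v e)
  incident? v e = (v ≟ end₁ e) ⊎-dec (v ≟ end₂ e)

  degree : Vertex → ℕ
  degree v = count (incident? v) (allFin size)

  Cubic : Set
  Cubic = ∀ v → degree v ≡ 3

-- Every vector of length n with entries from the given list, each listed once
-- when the list has no repetitions.
allVecs : ∀ {A : Set} → List A → ∀ n → List (Vec A n)
allVecs xs zero    = [] ∷ []
allVecs xs (suc n) = concatMap (λ x → List.map (x ∷_) (allVecs xs n)) xs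

allSubsets : ∀ n → List (Subset n)
allSubsets = allVecs (true ∷ false ∷ [])

Colour : Set
Colour = Fin 2

Colouring : ℕ → Set
Colouring m = Vec Colour m

allColourings : ∀ m → List (Colouring m)
allColourings = allVecs (List.allFin 2)

-- Expectation under the uniform distribution on the 2 ^ m colourings.
𝔼 : ∀ {m} → (Colouring m → ℤ) → ℚ
𝔼 {m} X = ℚ._/_ (foldr ℤ._+_ 0ℤ (List.map X (allColourings m))) (2 ^ m) {{m^n≢0 2 m}}

module _ {order : ℕ} (G : Graph order) where
  open Graph G

  PerfectMatching : Subset size → Set
  PerfectMatching M =
    ∀ v → count (λ e → (e ∈? M) ×-dec incident? v e) (allFin size) ≡ 1

  perfectMatching? : ∀ M → Dec (PerfectMatching M)
  perfectMatching? M =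
    all? λ v → count (λ e → (e ∈? M) ×-dec incident? v e) (allFin size) ℕ.≟ 1

  PerMat : ℕ
  PerMat = length (filter perfectMatching? (allSubsets size))

  degreeIn : Colouring size → Colour → Vertex → ℕ
  degreeIn c k v = count (λ e → (lookup c e ≟ k) ×-dec incident? v e) (allFin size)

  Monochromatic : Colouring size → Vertex → Set
  Monochromatic c v = ∃[ k ] degreeIn c k v ≡ 3

  monochromatic? : ∀ c v → Dec (Monochromatic c v)
  monochromatic? c v = any? λ k → degreeIn c k v ℕ.≟ 3

  monochromaticCount : Colouring size → ℕ
  monochromaticCount c = count (monochromatic? c) (allFin order)

  X : Colouring size → ℤ
  X c = -[1+ 2 ] ℤ.^ monochromaticCount c   -- -[1+ 2 ] is -3

{-# OPTIONS --safe #-}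

-- Split the first edge off and sum over its two colours: flipping the colour
-- of an edge changes the sign (-1) ^ q at both of its ends, and for local
-- weights (-1) ^ q * (a + b * (p - q)) in the numbers p, q of incident edges of
-- the two colours, the cross terms at the two ends cancel.  What remains is
-- twice the sum of two alternatives: leave the edge out (a and b are kept), or
-- match its ends along it (a, b become b, 0 at both ends).  So the sum over
-- colourings is 2 ^ size times a sum over edge sets in which a vertex covered
-- 0, 1, or more times weighs a, b, or 0.  Take a = 0 and b = -1: on p + q = 3
-- the local weight is -3 or 1 according as the vertex is monochromatic or not,
-- and each perfect matching weighs (-1) ^ order = 1.
module Submission where

import Algebra.Properties.Monoid.Sum
open import Data.Bool using (Bool; true; false; if_then_else_; _∨_)
open import Data.Fin using (Fin; zero; suc)
open import Data.Fin.Properties using (_≟_; any?; ¬∀⟶∃¬)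
open import Data.Fin.Subset using (Subset)
open import Data.Fin.Subset.Properties using (_∈?_)
open import Data.Integer as ℤ using (ℤ; +_; -[1+_]; 0ℤ; 1ℤ; -1ℤ)
import Data.Integer.Properties as ℤₚ
open import Data.Integer.Tactic.RingSolver using (solve-∀)
open import Data.List as List using (List; []; _∷_; _++_; filter; length)
import Data.List.Properties as Listₚ
open import Data.Nat as ℕ using (ℕ; zero; suc; _*_; _^_; NonZero)
open import Data.Nat.Properties as ℕₚ using (m^n≢0)
open import Data.Product using (_,_)
open import Data.Rational using (_/_)
open import Data.Rational.Properties using (fromℚᵘ-cong)
open import Data.Rational.Unnormalised using (mkℚᵘ; *≡*)
open import Data.Vec using (Vec; []; _∷_; count; lookup; tabulate; allFin)
open import Function using (id; _∘_)
open import Level using (0ℓ)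
open import Relation.Binary.PropositionalEquality
open import Relation.Nullary using (¬_; does; yes; no; _×-dec_; contradiction)
open import Relation.Nullary.Decidable using (dec-false)
open import Relation.Unary using (Pred; Decidable)
open import Defs

open Algebra.Properties.Monoid.Sum ℤₚ.*-1-monoid using (sum-cong-≗) renaming (sum to ∏)
open ≡-Reasoning

private variable
  A B   : Set
  k m n : ℕ

-- Integer sums over lists, in particular over all words in two letters.

∑ : (A → ℤ) → List A → ℤ
∑ F xs = List.foldr ℤ._+_ 0ℤ (List.map F xs)

∑-cong : {F F′ : A → ℤ} → F ≗ F′ → ∀ xs → ∑ F xs ≡ ∑ F′ xs
∑-cong eq xs = cong (List.foldr ℤ._+_ 0ℤ) (Listₚ.map-cong eq xs)

∑-++ : (F : A → ℤ) → ∀ xs ys → ∑ F (xs ++ ys) ≡ ∑ F xs ℤ.+ ∑ F ys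
∑-++ F []       ys = sym (ℤₚ.+-identityˡ _)
∑-++ F (x ∷ xs) ys =
  trans (cong (ℤ._+_ (F x)) (∑-++ F xs ys)) (sym (ℤₚ.+-assoc (F x) _ _))

∑-map : (F : B → ℤ) (f : A → B) → ∀ xs → ∑ F (List.map f xs) ≡ ∑ (F ∘ f) xs
∑-map F f xs = cong (List.foldr ℤ._+_ 0ℤ) (sym (Listₚ.map-∘ xs))

∑-+ : (F F′ : A → ℤ) → ∀ xs → ∑ F xs ℤ.+ ∑ F′ xs ≡ ∑ (λ x → F x ℤ.+ F′ x) xs
∑-+ F F′ []       = refl
∑-+ F F′ (x ∷ xs) =
  trans (interchange (F x) (F′ x) _ _) (cong (ℤ._+_ (F x ℤ.+ F′ x)) (∑-+ F F′ xs))
  where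
  interchange : ∀ a b c d → (a ℤ.+ c) ℤ.+ (b ℤ.+ d) ≡ (a ℤ.+ b) ℤ.+ (c ℤ.+ d)
  interchange = solve-∀

∑-*ˡ : ∀ i (F : A → ℤ) xs → ∑ (λ x → i ℤ.* F x) xs ≡ i ℤ.* ∑ F xs
∑-*ˡ i F []       = sym (ℤₚ.*-zeroʳ i)
∑-*ˡ i F (x ∷ xs) =
  trans (cong (ℤ._+_ (i ℤ.* F x)) (∑-*ˡ i F xs)) (sym (ℤₚ.*-distribˡ-+ i (F x) (∑ F xs)))

∑-filter : {P : Pred A 0ℓ} (P? : Decidable P) {F : A → ℤ} →
           (∀ x → P x → F x ≡ 1ℤ) → (∀ x → ¬ P x → F x ≡ 0ℤ) →
           ∀ xs → ∑ F xs ≡ + length (filter P? xs)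
∑-filter P? one zro []       = refl
∑-filter P? one zro (x ∷ xs) with P? x
... | yes px = cong₂ ℤ._+_ (one x px) (∑-filter P? one zro xs)
... | no ¬px = trans (cong₂ ℤ._+_ (zro x ¬px) (∑-filter P? one zro xs)) (ℤₚ.+-identityˡ _)

∑-allVecs-suc : ∀ (x y : A) (F : Vec A (suc m) → ℤ) → let xs = x ∷ y ∷ [] in
                ∑ F (allVecs xs (suc m)) ≡
                ∑ (F ∘ (x ∷_)) (allVecs xs m) ℤ.+ ∑ (F ∘ (y ∷_)) (allVecs xs m)
∑-allVecs-suc {m = m} x y F = begin
  -- `concatMap` over the two letters ends in the empty list, hence the trailing `++ []`.
  ∑ F (List.map (x ∷_) vs ++ List.map (y ∷_) vs ++ [])
    ≡⟨ ∑-++ F (List.map (x ∷_) vs) _ ⟩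
  ∑ F (List.map (x ∷_) vs) ℤ.+ ∑ F (List.map (y ∷_) vs ++ [])
    ≡⟨ cong (λ ys → ∑ F (List.map (x ∷_) vs) ℤ.+ ∑ F ys) (Listₚ.++-identityʳ (List.map (y ∷_) vs)) ⟩
  ∑ F (List.map (x ∷_) vs) ℤ.+ ∑ F (List.map (y ∷_) vs)
    ≡⟨ cong₂ ℤ._+_ (∑-map F (x ∷_) vs) (∑-map F (y ∷_) vs) ⟩
  ∑ (F ∘ (x ∷_)) vs ℤ.+ ∑ (F ∘ (y ∷_)) vs ∎
  where vs = allVecs (x ∷ y ∷ []) m

-- Products over the vertices.

∏-const : ∀ i n → ∏ {n} (λ _ → i) ≡ i ℤ.^ n
∏-const i zero    = refl
∏-const i (suc n) = cong (i ℤ.*_) (∏-const i n)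

∏-zero : (f : Fin n → ℤ) (v : Fin n) → f v ≡ 0ℤ → ∏ f ≡ 0ℤ
∏-zero f zero    eq = cong (λ i → i ℤ.* ∏ (f ∘ suc)) eq
∏-zero f (suc v) eq =
  trans (cong (f zero ℤ.*_) (∏-zero (f ∘ suc) v eq)) (ℤₚ.*-zeroʳ (f zero))

^-count : {P : Pred A 0ℓ} (P? : Decidable P) (i : ℤ) (f : Fin n → A) →
          i ℤ.^ count P? (tabulate f) ≡ ∏ (λ v → if does (P? (f v)) then i else 1ℤ)
^-count {n = zero}  P? i f = refl
^-count {n = suc n} P? i f with does (P? (f zero))
... | true  = cong (i ℤ.*_) (^-count P? i (f ∘ suc))
... | false = trans (^-count P? i (f ∘ suc)) (sym (ℤₚ.*-identityˡ _))

-- The extracted factor leaves `1ℤ` behind, so the index set stays `Fin n` and a second vertex can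
-- be split off in the same way.
∏-at : ∀ (u : Fin n) (f x : Fin n → ℤ) →
       ∏ (λ v → if does (v ≟ u) then f v else x v) ≡
       f u ℤ.* ∏ (λ v → if does (v ≟ u) then 1ℤ else x v)
∏-at zero    f x = cong (f zero ℤ.*_) (sym (ℤₚ.*-identityˡ _))
∏-at (suc u) f x =
  trans (cong (x zero ℤ.*_) (∏-at u (f ∘ suc) (x ∘ suc))) (swap (x zero) (f (suc u)) _)
  where
  swap : ∀ a b c → a ℤ.* (b ℤ.* c) ≡ b ℤ.* (a ℤ.* c)
  swap = solve-∀

module _ {u w : Fin n} (u≢w : u ≢ w) where

  private
    at : Fin n → Bool
    at v = does (v ≟ u) ∨ does (v ≟ w)

  ∏-at₂ : (f x : Fin n → ℤ) →
          ∏ (λ v → if at v then f v else x v) ≡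
          f u ℤ.* (f w ℤ.* ∏ (λ v → if at v then 1ℤ else x v))
  ∏-at₂ f x = begin
    ∏ (λ v → if at v then f v else x v)
      ≡⟨ sum-cong-≗ (λ v → if-∨ (does (v ≟ u)) (does (v ≟ w))) ⟩
    ∏ (λ v → if does (v ≟ u) then f v else if does (v ≟ w) then f v else x v)
      ≡⟨ ∏-at u f _ ⟩
    f u ℤ.* ∏ (λ v → if does (v ≟ u) then 1ℤ else if does (v ≟ w) then f v else x v)
      ≡⟨ cong (f u ℤ.*_) (sum-cong-≗ λ v → if-swap (does (v ≟ u)) (does (v ≟ w))) ⟩
    f u ℤ.* ∏ (λ v → if does (v ≟ w) then f′ v else if does (v ≟ u) then 1ℤ else x v)
      ≡⟨ cong (f u ℤ.*_) (∏-at w f′ _) ⟩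
    f u ℤ.* (f′ w ℤ.* ∏ (λ v → if does (v ≟ w) then 1ℤ else if does (v ≟ u) then 1ℤ else x v))
      ≡⟨ cong (f u ℤ.*_) (cong₂ ℤ._*_
           (cong (if_then 1ℤ else f w) (dec-false (w ≟ u) (u≢w ∘ sym)))
           (sum-cong-≗ λ v → if-∨′ (does (v ≟ u)) (does (v ≟ w)))) ⟩
    f u ℤ.* (f w ℤ.* ∏ (λ v → if at v then 1ℤ else x v)) ∎
    where
    -- The factor at `u` is already taken out, so `f′` is `1ℤ` there; `u≢w` gives `f′ w ≡ f w`.
    f′ : Fin n → ℤ
    f′ v = if does (v ≟ u) then 1ℤ else f v

    if-∨ : ∀ b c {i j : ℤ} → (if b ∨ c then i else j) ≡ (if b then i else if c then i else j)
    if-∨ true  c = refl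
    if-∨ false c = refl

    if-swap : ∀ b c {i j l : ℤ} →
              (if b then l else if c then i else j) ≡
              (if c then (if b then l else i) else if b then l else j)
    if-swap true  true  = refl
    if-swap true  false = refl
    if-swap false c     = refl

    if-∨′ : ∀ b c {i j : ℤ} → (if c then i else if b then i else j) ≡ (if b ∨ c then i else j)
    if-∨′ true  true  = refl
    if-∨′ true  false = refl
    if-∨′ false c     = refl

  -- Once the factor `r` of the other vertices is taken out, this is (a + b)(c + d) + (b - a)(d - c)
  -- = 2(bd + ac). The products on the left will belong to the two colours of an edge with ends `u`
  -- and `w`.
  ∏-sum-difference : (x y : Fin n → ℤ) →
    ∏ (λ v → if at v then x v ℤ.+ y v else x v) ℤ.+ ∏ (λ v → if at v then y v ℤ.- x v else x v) ≡
    + 2 ℤ.* (∏ (λ v → if at v then y v else x v) ℤ.+ ∏ x)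
  ∏-sum-difference x y = begin
    ∏ (λ v → if at v then x v ℤ.+ y v else x v) ℤ.+ ∏ (λ v → if at v then y v ℤ.- x v else x v)
      ≡⟨ cong₂ ℤ._+_ (∏-at₂ _ x) (∏-at₂ _ x) ⟩
    (x u ℤ.+ y u) ℤ.* ((x w ℤ.+ y w) ℤ.* r) ℤ.+ (y u ℤ.- x u) ℤ.* ((y w ℤ.- x w) ℤ.* r)
      ≡⟨ identity (x u) (y u) (x w) (y w) r ⟩
    + 2 ℤ.* (y u ℤ.* (y w ℤ.* r) ℤ.+ x u ℤ.* (x w ℤ.* r))
      ≡⟨ cong (+ 2 ℤ.*_) (cong₂ ℤ._+_ (∏-at₂ y x)
           (trans (sum-cong-≗ λ v → sym (if-same (at v))) (∏-at₂ x x))) ⟨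
    + 2 ℤ.* (∏ (λ v → if at v then y v else x v) ℤ.+ ∏ x) ∎
    where
    r = ∏ (λ v → if at v then 1ℤ else x v)

    identity : ∀ a b c d r →
      (a ℤ.+ b) ℤ.* ((c ℤ.+ d) ℤ.* r) ℤ.+ (b ℤ.- a) ℤ.* ((d ℤ.- c) ℤ.* r) ≡
      + 2 ℤ.* (b ℤ.* (d ℤ.* r) ℤ.+ a ℤ.* (c ℤ.* r))
    identity = solve-∀

    if-same : ∀ b {i : ℤ} → (if b then i else i) ≡ i
    if-same true  = refl
    if-same false = refl

-- Local weights of colourings and of edge sets.

count-tabulate : {P : Pred A 0ℓ} {Q : Pred B 0ℓ} (P? : Decidable P) (Q? : Decidable Q)
                 (f : Fin m → A) (g : Fin m → B) →
                 (∀ i → does (P? (f i)) ≡ does (Q? (g i))) →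
                 count P? (tabulate f) ≡ count Q? (tabulate g)
count-tabulate {m = zero}  P? Q? f g eq = refl
count-tabulate {m = suc m} P? Q? f g eq =
  cong₂ (λ b → if b then suc else id) (eq zero)
    (count-tabulate P? Q? (f ∘ suc) (g ∘ suc) (eq ∘ suc))

-- Give the edges of the two colours the signs 1 and -1. Then (-1)^q is the product of the signs at
-- the vertex and p - q is their sum, so that, up to this product, `a` and `b` are the coefficients
-- of the elementary symmetric polynomials of degrees 0 and 1.
colourWeight : ℤ → ℤ → ℕ → ℕ → ℤ
colourWeight a b p q = -1ℤ ℤ.^ q ℤ.* (a ℤ.+ b ℤ.* (+ p ℤ.- + q))

colourWeight-sucˡ : ∀ a b p q →
  colourWeight a b (suc p) q ≡ colourWeight a b p q ℤ.+ colourWeight b 0ℤ p q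
colourWeight-sucˡ a b p q = identity (-1ℤ ℤ.^ q) a b (+ p) (+ q)
  where
  identity : ∀ s a b p q → s ℤ.* (a ℤ.+ b ℤ.* ((1ℤ ℤ.+ p) ℤ.- q)) ≡
    s ℤ.* (a ℤ.+ b ℤ.* (p ℤ.- q)) ℤ.+ s ℤ.* (b ℤ.+ 0ℤ ℤ.* (p ℤ.- q))
  identity = solve-∀

-- The sign flips and the bracket loses `b`, so the old weight is negated while the increment stays
-- positive: the difference that `∏-sum-difference` expects.
colourWeight-sucʳ : ∀ a b p q →
  colourWeight a b p (suc q) ≡ colourWeight b 0ℤ p q ℤ.- colourWeight a b p q
colourWeight-sucʳ a b p q = identity (-1ℤ ℤ.^ q) a b (+ p) (+ q)
  where
  identity : ∀ s a b p q → (-1ℤ ℤ.* s) ℤ.* (a ℤ.+ b ℤ.* (p ℤ.- (1ℤ ℤ.+ q))) ≡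
    s ℤ.* (b ℤ.+ 0ℤ ℤ.* (p ℤ.- q)) ℤ.- s ℤ.* (a ℤ.+ b ℤ.* (p ℤ.- q))
  identity = solve-∀

matchingWeight : ℤ → ℤ → ℕ → ℤ
matchingWeight a b 0             = a
matchingWeight a b 1             = b
matchingWeight a b (suc (suc _)) = 0ℤ

-- As a function of `k` the weight is the sequence a, b, 0, 0, ...; dropping its first term turns
-- the pair `a`, `b` into `b`, `0ℤ`, just as in the increments of `colourWeight`.
matchingWeight-suc : ∀ a b k → matchingWeight a b (suc k) ≡ matchingWeight b 0ℤ k
matchingWeight-suc a b 0             = refl
matchingWeight-suc a b 1             = refl
matchingWeight-suc a b (suc (suc _)) = refl

coverage : (G : Graph n) → Subset (Graph.size G) → Fin n → ℕ
coverage G M v = count (λ e → (e ∈? M) ×-dec Graph.incident? G v e) (allFin (Graph.size G))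

colourSum : (G : Graph n) (a b : Fin n → ℤ) → Colouring (Graph.size G) → ℤ
colourSum G a b c =
  ∏ λ v → colourWeight (a v) (b v) (degreeIn G c zero v) (degreeIn G c (suc zero) v)

matchingSum : (G : Graph n) (a b : Fin n → ℤ) → Subset (Graph.size G) → ℤ
matchingSum G a b M = ∏ λ v → matchingWeight (a v) (b v) (coverage G M v)

graph : (s t : Fin m → Fin n) → (∀ e → s e ≢ t e) → Graph n
graph s t s≢t = record { end₁ = s ; end₂ = t ; loopless = s≢t }

-- Deleting the first edge, and induction on the number of edges.

module _ (s t : Fin (suc m) → Fin n) (s≢t : ∀ e → s e ≢ t e) where

  private
    G G⁻ : Graph n
    G  = graph s t s≢t
    G⁻ = graph (s ∘ suc) (t ∘ suc) (s≢t ∘ suc)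

    at : Fin n → Bool
    at v = does (v ≟ s zero) ∨ does (v ≟ t zero)

  degreeIn-∷ : ∀ d c k v → degreeIn G (d ∷ c) k v ≡
    (if does ((d ≟ k) ×-dec Graph.incident? G v zero) then suc else id) (degreeIn G⁻ c k v)
  degreeIn-∷ d c k v =
    cong (if does ((d ≟ k) ×-dec Graph.incident? G v zero) then suc else id)
      (count-tabulate (λ e → (lookup (d ∷ c) e ≟ k) ×-dec Graph.incident? G v e)
        (λ e → (lookup c e ≟ k) ×-dec Graph.incident? G⁻ v e) suc id (λ _ → refl))

  coverage-∷ : ∀ b M v → coverage G (b ∷ M) v ≡
    (if does ((zero ∈? (b ∷ M)) ×-dec Graph.incident? G v zero) then suc else id) (coverage G⁻ M v)
  coverage-∷ b M v =
    cong (if does ((zero ∈? (b ∷ M)) ×-dec Graph.incident? G v zero) then suc else id)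
      (count-tabulate (λ e → (e ∈? (b ∷ M)) ×-dec Graph.incident? G v e)
        -- `suc e ∈ b ∷ M` and `e ∈ M` are different propositions, so the counts are compared
        -- through the Booleans of their decisions, which agree by computation.
        (λ e → (e ∈? M) ×-dec Graph.incident? G⁻ v e) suc id (λ _ → refl))

  module _ (a b : Fin n → ℤ) where

    private
      a′ b′ : Fin n → ℤ
      a′ v = if at v then b v else a v
      b′ v = if at v then 0ℤ  else b v

    colourSum-∷ : ∀ c →
      colourSum G a b (zero ∷ c) ℤ.+ colourSum G a b (suc zero ∷ c) ≡
      + 2 ℤ.* (colourSum G⁻ a′ b′ c ℤ.+ colourSum G⁻ a b c)
    colourSum-∷ c = begin
      colourSum G a b (zero ∷ c) ℤ.+ colourSum G a b (suc zero ∷ c)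
        ≡⟨ cong₂ ℤ._+_ (sum-cong-≗ first) (sum-cong-≗ second) ⟩
      ∏ (λ v → if at v then x v ℤ.+ y v else x v) ℤ.+ ∏ (λ v → if at v then y v ℤ.- x v else x v)
        ≡⟨ ∏-sum-difference (s≢t zero) x y ⟩
      + 2 ℤ.* (∏ (λ v → if at v then y v else x v) ℤ.+ ∏ x)
        ≡⟨ cong (λ z → + 2 ℤ.* (z ℤ.+ ∏ x)) (sum-cong-≗ λ v → matched (at v) (a v) (b v) (p v) (q v)) ⟩
      + 2 ℤ.* (colourSum G⁻ a′ b′ c ℤ.+ colourSum G⁻ a b c) ∎
      where
      p q : Fin n → ℕ
      p = degreeIn G⁻ c zero
      q = degreeIn G⁻ c (suc zero)

      x y : Fin n → ℤ
      x v = colourWeight (a v) (b v) (p v) (q v)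
      y v = colourWeight (b v) 0ℤ (p v) (q v)

      first : ∀ v → colourWeight (a v) (b v) (degreeIn G (zero ∷ c) zero v)
                                             (degreeIn G (zero ∷ c) (suc zero) v) ≡
                    (if at v then x v ℤ.+ y v else x v)
      -- The new edge has colour `zero`: the second degree is unchanged by computation, and the
      -- first grows exactly when `at v` is `true`.
      first v rewrite degreeIn-∷ zero c zero v | degreeIn-∷ zero c (suc zero) v with at v
      ... | true  = colourWeight-sucˡ (a v) (b v) (p v) (q v)
      ... | false = refl

      second : ∀ v → colourWeight (a v) (b v) (degreeIn G (suc zero ∷ c) zero v)
                                              (degreeIn G (suc zero ∷ c) (suc zero) v) ≡
                     (if at v then y v ℤ.- x v else x v)
      second v rewrite degreeIn-∷ (suc zero) c zero v | degreeIn-∷ (suc zero) c (suc zero) v with at v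
      ... | true  = colourWeight-sucʳ (a v) (b v) (p v) (q v)
      ... | false = refl

      matched : ∀ β i j k l →
        (if β then colourWeight j 0ℤ k l else colourWeight i j k l) ≡
        colourWeight (if β then j else i) (if β then 0ℤ else j) k l
      matched true  i j k l = refl
      matched false i j k l = refl

    matchingSum-true : ∀ M → matchingSum G a b (true ∷ M) ≡ matchingSum G⁻ a′ b′ M
    matchingSum-true M = sum-cong-≗ pointwise
      where
      pointwise : ∀ v → matchingWeight (a v) (b v) (coverage G (true ∷ M) v) ≡
                        matchingWeight (a′ v) (b′ v) (coverage G⁻ M v)
      pointwise v rewrite coverage-∷ true M v with at v
      ... | true  = matchingWeight-suc (a v) (b v) (coverage G⁻ M v)
      ... | false = refl

    matchingSum-false : ∀ M → matchingSum G a b (false ∷ M) ≡ matchingSum G⁻ a b M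
    matchingSum-false M =
      sum-cong-≗ λ v → cong (matchingWeight (a v) (b v)) (coverage-∷ false M v)

-- Deleting an edge destroys cubicity and changes the weights at its ends, so the induction runs
-- over all end maps and all `a`, `b`.
∑-colourSum : ∀ m (s t : Fin m → Fin n) (s≢t : ∀ e → s e ≢ t e) (a b : Fin n → ℤ) →
  let G = graph s t s≢t in
  ∑ (colourSum G a b) (allColourings m) ≡ + (2 ^ m) ℤ.* ∑ (matchingSum G a b) (allSubsets m)
∑-colourSum zero s t s≢t a b =
  -- Without edges both sums have a single term, in which each vertex weighs `a v`.
  trans (cong (λ i → i ℤ.+ 0ℤ) (sum-cong-≗ λ v → weightless (a v) (b v))) (sym (ℤₚ.*-identityˡ _))
  where
  weightless : ∀ i j → 1ℤ ℤ.* (i ℤ.+ j ℤ.* 0ℤ) ≡ i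
  weightless = solve-∀
∑-colourSum {n = n} (suc m) s t s≢t a b = begin
  ∑ (colourSum G a b) (allColourings (suc m))
    ≡⟨ ∑-allVecs-suc zero (suc zero) (colourSum G a b) ⟩
  ∑ (colourSum G a b ∘ (zero ∷_)) cs ℤ.+ ∑ (colourSum G a b ∘ (suc zero ∷_)) cs
    ≡⟨ ∑-+ _ _ cs ⟩
  ∑ (λ c → colourSum G a b (zero ∷ c) ℤ.+ colourSum G a b (suc zero ∷ c)) cs
    ≡⟨ ∑-cong (colourSum-∷ s t s≢t a b) cs ⟩
  ∑ (λ c → + 2 ℤ.* (colourSum G⁻ a′ b′ c ℤ.+ colourSum G⁻ a b c)) cs
    ≡⟨ ∑-*ˡ (+ 2) _ cs ⟩
  + 2 ℤ.* ∑ (λ c → colourSum G⁻ a′ b′ c ℤ.+ colourSum G⁻ a b c) cs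
    ≡⟨ cong (+ 2 ℤ.*_) (∑-+ (colourSum G⁻ a′ b′) (colourSum G⁻ a b) cs) ⟨
  + 2 ℤ.* (∑ (colourSum G⁻ a′ b′) cs ℤ.+ ∑ (colourSum G⁻ a b) cs)
    ≡⟨ cong (+ 2 ℤ.*_) (cong₂ ℤ._+_
         (∑-colourSum m (s ∘ suc) (t ∘ suc) (s≢t ∘ suc) a′ b′)
         (∑-colourSum m (s ∘ suc) (t ∘ suc) (s≢t ∘ suc) a b)) ⟩
  + 2 ℤ.* (+ (2 ^ m) ℤ.* ∑ (matchingSum G⁻ a′ b′) Ms ℤ.+ + (2 ^ m) ℤ.* ∑ (matchingSum G⁻ a b) Ms)
    ≡⟨ factor (+ 2) (+ (2 ^ m)) _ _ ⟩
  + 2 ℤ.* + (2 ^ m) ℤ.* (∑ (matchingSum G⁻ a′ b′) Ms ℤ.+ ∑ (matchingSum G⁻ a b) Ms)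
    -- A leading `true` selects the first edge and turns the weights into `a′`, `b′`; a leading
    -- `false` keeps `a`, `b`.
    ≡⟨ cong₂ ℤ._*_ (ℤₚ.pos-* 2 (2 ^ m)) (cong₂ ℤ._+_
         (∑-cong (matchingSum-true s t s≢t a b) Ms)
         (∑-cong (matchingSum-false s t s≢t a b) Ms)) ⟨
  + (2 ^ suc m) ℤ.* (∑ (matchingSum G a b ∘ (true ∷_)) Ms ℤ.+ ∑ (matchingSum G a b ∘ (false ∷_)) Ms)
    ≡⟨ cong (+ (2 ^ suc m) ℤ.*_) (∑-allVecs-suc true false (matchingSum G a b)) ⟨
  + (2 ^ suc m) ℤ.* ∑ (matchingSum G a b) (allSubsets (suc m)) ∎
  where
  G G⁻ : Graph n
  G  = graph s t s≢t
  G⁻ = graph (s ∘ suc) (t ∘ suc) (s≢t ∘ suc)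

  cs = allColourings m
  Ms = allSubsets m

  a′ b′ : Fin n → ℤ
  a′ v = if does (v ≟ s zero) ∨ does (v ≟ t zero) then b v else a v
  b′ v = if does (v ≟ s zero) ∨ does (v ≟ t zero) then 0ℤ  else b v

  factor : ∀ i j k l → i ℤ.* (j ℤ.* k ℤ.+ j ℤ.* l) ≡ i ℤ.* j ℤ.* (k ℤ.+ l)
  factor = solve-∀

-- Cubic graphs with the weights 0 and -1.

count-by-colour : {P : Pred A 0ℓ} (P? : Decidable P) (c : A → Colour) (xs : Vec A k) →
  count (λ x → (c x ≟ zero) ×-dec P? x) xs ℕ.+ count (λ x → (c x ≟ suc zero) ×-dec P? x) xs ≡
  count P? xs
count-by-colour P? c []       = refl
count-by-colour P? c (x ∷ xs) with c x | does (P? x)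
... | zero     | true  = cong suc (count-by-colour P? c xs)
... | zero     | false = count-by-colour P? c xs
... | suc zero | true  = trans (ℕₚ.+-suc _ _) (cong suc (count-by-colour P? c xs))
... | suc zero | false = count-by-colour P? c xs

-- For p = 0, 1, 2, 3 and q = 3 - p the value (-1)^q (q - p) is -3, 1, 1, -3.
monochromatic-weight : (f : Colour → ℕ) → f zero ℕ.+ f (suc zero) ≡ 3 →
  (if does (any? λ k → f k ℕ.≟ 3) then -[1+ 2 ] else 1ℤ) ≡ colourWeight 0ℤ -1ℤ (f zero) (f (suc zero))
monochromatic-weight f eq with f zero | f (suc zero)
monochromatic-weight f refl | 0 | .3 = refl
monochromatic-weight f refl | 1 | .2 = refl
monochromatic-weight f refl | 2 | .1 = refl
monochromatic-weight f refl | 3 | .0 = refl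

X≡colourSum : (G : Graph n) → Graph.Cubic G → ∀ c → X G c ≡ colourSum G (λ _ → 0ℤ) (λ _ → -1ℤ) c
X≡colourSum G cubic c = begin
  X G c
    ≡⟨ ^-count (monochromatic? G c) -[1+ 2 ] id ⟩
  ∏ (λ v → if does (monochromatic? G c v) then -[1+ 2 ] else 1ℤ)
    -- Cubicity enters here: the two colour degrees at each vertex add up to 3.
    ≡⟨ sum-cong-≗ (λ v → monochromatic-weight (λ k → degreeIn G c k v)
         (trans (count-by-colour (incident? v) (lookup c) (allFin size)) (cubic v))) ⟩
  colourSum G (λ _ → 0ℤ) (λ _ → -1ℤ) c ∎
  where open Graph G

∑-matchingSum : ∀ n (G : Graph (2 * n)) →
  ∑ (matchingSum G (λ _ → 0ℤ) (λ _ → -1ℤ)) (allSubsets (Graph.size G)) ≡ + PerMat G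
∑-matchingSum n G = ∑-filter (perfectMatching? G) perfect imperfect (allSubsets (Graph.size G))
  where
  perfect : ∀ M → PerfectMatching G M → matchingSum G (λ _ → 0ℤ) (λ _ → -1ℤ) M ≡ 1ℤ
  perfect M pm = begin
    matchingSum G (λ _ → 0ℤ) (λ _ → -1ℤ) M
      ≡⟨ sum-cong-≗ (λ v → cong (matchingWeight 0ℤ -1ℤ) (pm v)) ⟩
    ∏ {2 * n} (λ _ → -1ℤ) ≡⟨ ∏-const -1ℤ (2 * n) ⟩
    -- The even order enters here: `-1ℤ ℤ.^ 2` computes to `1ℤ`.
    -1ℤ ℤ.^ (2 * n)       ≡⟨ ℤₚ.^-*-assoc -1ℤ 2 n ⟨
    1ℤ ℤ.^ n              ≡⟨ ℤₚ.^-zeroˡ n ⟩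
    1ℤ                    ∎

  weight-≢1 : ∀ k → k ≢ 1 → matchingWeight 0ℤ -1ℤ k ≡ 0ℤ
  weight-≢1 0             _   = refl
  weight-≢1 1             1≢1 = contradiction refl 1≢1
  weight-≢1 (suc (suc _)) _   = refl

  imperfect : ∀ M → ¬ PerfectMatching G M → matchingSum G (λ _ → 0ℤ) (λ _ → -1ℤ) M ≡ 0ℤ
  -- Decidability yields a vertex `v` not covered exactly once, whose weight 0 annihilates the
  -- product.
  imperfect M ¬pm with ¬∀⟶∃¬ _ _ (λ v → coverage G M v ℕ.≟ 1) ¬pm
  ... | v , k≢1 = ∏-zero (λ v → matchingWeight 0ℤ -1ℤ (coverage G M v)) v (weight-≢1 _ k≢1)

/-cancelˡ : ∀ i d .{{_ : NonZero d}} → i / 1 ≡ (+ d ℤ.* i) / d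
/-cancelˡ i (suc d) =
  -- Normalised fractions are compared through unnormalised ones, where cross-multiplication
  -- suffices. `mkℚᵘ` stores the denominator minus one, so `0` means 1 and `d` means `suc d`.
  fromℚᵘ-cong {mkℚᵘ i 0} {mkℚᵘ (+ suc d ℤ.* i) d} (*≡* (identity i (+ suc d)))
  where
  identity : ∀ i j → i ℤ.* j ≡ j ℤ.* i ℤ.* 1ℤ
  identity = solve-∀

theorem1p6 : (n : ℕ) (G : Graph (2 * n)) → Graph.Cubic G → (+ PerMat G) / 1 ≡ 𝔼 (X G)
theorem1p6 n G cubic = begin
  (+ PerMat G) / 1
    ≡⟨ /-cancelˡ (+ PerMat G) (2 ^ size) ⟩
  (+ (2 ^ size) ℤ.* + PerMat G) / 2 ^ size
    ≡⟨ cong (λ i → i / 2 ^ size) numerator ⟨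
  𝔼 (X G) ∎
  where
  open Graph G

  -- This is the proof used in `𝔼`, so the fraction with numerator `∑ (X G) (allColourings size)` is
  -- `𝔼 (X G)` by definition.
  instance
    2^size≢0 : NonZero (2 ^ size)
    2^size≢0 = m^n≢0 2 size

  numerator : ∑ (X G) (allColourings size) ≡ + (2 ^ size) ℤ.* + PerMat G
  numerator = begin
    ∑ (X G) (allColourings size)
      ≡⟨ ∑-cong (X≡colourSum G cubic) (allColourings size) ⟩
    ∑ (colourSum G (λ _ → 0ℤ) (λ _ → -1ℤ)) (allColourings size)
      -- By eta for records, `graph end₁ end₂ loopless` is `G` itself.
      ≡⟨ ∑-colourSum size end₁ end₂ loopless (λ _ → 0ℤ) (λ _ → -1ℤ) ⟩
    + (2 ^ size) ℤ.* ∑ (matchingSum G (λ _ → 0ℤ) (λ _ → -1ℤ)) (allSubsets size)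
      ≡⟨ cong (+ (2 ^ size) ℤ.*_) (∑-matchingSum n G) ⟩
    + (2 ^ size) ℤ.* + PerMat G ∎
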